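{- The only Fibonacci numbers that are squares of Lucas numbers (with positive indices) are $F_1 = L_1^2 = 1$ and $F_2 = L_1^2 = 1$; that is, for positive integers $k, n$, the equation $F_k = L_n^2$ holds if and only if $(k,n) \in \{(1,1),\ (2,1)\}$.
   Context: $(F_n)_{n\geqslant 0}$ is the Fibonacci sequence: $F_0=0$, $F_1=1$, $F_{n+1}=F_n+F_{n-1}$ for $n \geqslant 1$. $(L_n)_{n\geqslant 0}$ is the Lucas sequence: $L_0=2$, $L_1=1$, $L_{n+1}=L_n+L_{n-1}$ for $n\geqslant 1$. -}

module Defs where

open import Data.Nat using (ℕ; zero; suc; _+_)

F : ℕ → ℕ
F zero          = 0
F (suc zero)    = 1
F (suc (suc n)) = F (suc n) + F n

L : ℕ → ℕ
L zero          = 2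
L (suc zero)    = 1
L (suc (suc n)) = L (suc n) + L n

{-# OPTIONS --safe #-}
-- For n ≥ 3 the square L n ^ 2 lies strictly between the consecutive Fibonacci
-- numbers F (2n+1) and F (2n+2). With d = F (n-3) and c = F (n-2), the addition
-- formula expresses all three as quadratic forms in c and d, and the two
-- differences, 3c² + 8cd + 4d² and 5c² + 2cd - d², are positive since c ≥ d, c ≥ 1.
module Submission where

open import Defs
open import Data.Nat using (ℕ; zero; suc; _+_; _*_; _∸_; _^_; _≤_; _<_; _≥_; z≤n; s≤s; _≤′_; ≤′-reflexive; ≤′-step)
open import Data.Nat.Properties
open import Data.Nat.Tactic.RingSolver using (solve-∀)
open import Data.Product using (_,_)
open import Data.Sum using (_⊎_; inj₁; inj₂)
open import Function.Bundles using (_⇔_; mk⇔)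
open import Relation.Binary.PropositionalEquality using (_≡_; _≢_; refl; sym; trans; cong; cong₂; subst)
open import Relation.Nullary using (contradiction)

F[n]≤F[1+n] : ∀ n → F n ≤ F (suc n)
F[n]≤F[1+n] zero    = z≤n
F[n]≤F[1+n] (suc n) = m≤m+n (F (suc n)) (F n)

F-mono-≤ : ∀ {m n} → m ≤ n → F m ≤ F n
F-mono-≤ m≤n = go (≤⇒≤′ m≤n)
  where
  go : ∀ {m n} → m ≤′ n → F m ≤ F n
  go (≤′-reflexive refl)       = ≤-refl
  go {n = suc n} (≤′-step m≤n) = ≤-trans (go m≤n) (F[n]≤F[1+n] n)

F[1+n]>0 : ∀ n → 0 < F (suc n)
F[1+n]>0 n = F-mono-≤ {1} {suc n} (s≤s z≤n)

-- By monotonicity, indices up to `j` give values below `x` and all later ones give values above it.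
F-gap : ∀ j {x} → F j < x → x < F (suc j) → ∀ k → F k ≢ x
F-gap j Fj<x x<Fj⁺ k Fk≡x with ≤-<-connex k j
... | inj₁ k≤j = <-irrefl Fk≡x (≤-<-trans (F-mono-≤ k≤j) Fj<x)
... | inj₂ j<k = <-irrefl (sym Fk≡x) (<-≤-trans x<Fj⁺ (F-mono-≤ j<k))

-- As functions of `m`, both sides obey the Fibonacci recurrence, so agreement at 0 and 1 suffices.
F-+ : ∀ m n → F (suc (m + n)) ≡ F (suc m) * F (suc n) + F m * F n
F-+ zero          n = sym (trans (+-identityʳ _) (+-identityʳ _))
F-+ (suc zero)    n = sym (cong₂ _+_ (+-identityʳ (F (suc n))) (+-identityʳ (F n)))
F-+ (suc (suc m)) n = trans (cong₂ _+_ (F-+ (suc m) n) (F-+ m n))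
  (regroup (F (suc m)) (F m) (F (suc n)) (F n))
  where
  regroup : ∀ a b x y →
    ((a + b) * x + a * y) + (a * x + b * y) ≡ ((a + b) + a) * x + (a + b) * y
  regroup = solve-∀

L≡F+F : ∀ n → L (suc n) ≡ F (suc (suc n)) + F n
L≡F+F zero          = refl
L≡F+F (suc zero)    = refl
L≡F+F (suc (suc n)) = trans (cong₂ _+_ (L≡F+F (suc n)) (L≡F+F n))
  (regroup (F (suc n)) (F n))
  where
  regroup : ∀ a b → (a + b + a + a) + (a + b + b) ≡ (a + b + a + (a + b)) + (a + b)
  regroup = solve-∀

-- Reduces a strict inequality to a subtraction-free polynomial identity with an explicit positive
-- gap `z`.
<-by-difference : ∀ {x x′ y y′ z} → x ≡ x′ → y ≡ y′ → y′ ≡ x′ + z → 0 < z → x < y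
<-by-difference {x} refl refl y≡x+z 0<z = subst (x <_) (sym y≡x+z) (m<m+n x 0<z)

L[3+p]² : ∀ p → L (3 + p) ^ 2 ≡ (4 * F (1 + p) + 3 * F p) ^ 2
L[3+p]² p = cong (_^ 2) (trans (L≡F+F (2 + p)) (collect (F (1 + p)) (F p)))
  where
  collect : ∀ c d → (c + d + c + (c + d)) + (c + d) ≡ 4 * c + 3 * d
  collect = solve-∀

F<L² : ∀ p → let n = 3 + p in F (suc (n + n)) < L n ^ 2
F<L² p = <-by-difference (F-+ (3 + p) (3 + p)) (L[3+p]² p) (difference c d)
  (<-≤-trans (*-mono-≤ (F[1+n]>0 p) (F[1+n]>0 p)) (m≤m+n (c * c) _))
  where
  c = F (1 + p)
  d = F p
  -- Here `f` and `g` are `F (3 + p)` and `F (4 + p)`, and the product ending in `* 1` is the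
  -- unfolded square. One `c * c` is split off the gap because it alone is at least 1.
  difference : ∀ c d → let f = c + d + c ; g = f + (c + d) in
    (4 * c + 3 * d) * ((4 * c + 3 * d) * 1)
      ≡ (g * g + f * f) + (c * c + (2 * (c * c) + 8 * (c * d) + 4 * (d * d)))
  difference = solve-∀

L²<F : ∀ p → let n = 3 + p in L n ^ 2 < F (suc (suc (n + n)))
-- 5c² + 2cd - d² = c² + (4c² + cd + d(c - d)), with c ∸ d exact since d ≤ c.
L²<F p = <-by-difference
  -- `F (2n+2)` unfolds to `F (2n+1) + F (2n)`, where `2n = 1 + (2 + p) + (3 + p)`.
  (L[3+p]² p) (cong₂ _+_ (F-+ (3 + p) (3 + p)) (F-+ (2 + p) (3 + p))) eq
  (<-≤-trans (*-mono-≤ (F[1+n]>0 p) (F[1+n]>0 p)) (m≤m+n (c * c) _))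
  where
  c = F (1 + p)
  d = F p
  -- A free `e` stands for `c ∸ d`, which keeps the identity polynomial.
  difference : ∀ e d → let c = d + e ; f = c + d + c ; g = f + (c + d) in
    (g * g + f * f) + (f * g + (c + d) * f)
      ≡ (4 * c + 3 * d) * ((4 * c + 3 * d) * 1) + (c * c + (4 * (c * c) + c * d + d * e))
  difference = solve-∀
  eq : let f = c + d + c ; g = f + (c + d) in
    (g * g + f * f) + (f * g + (c + d) * f)
      ≡ (4 * c + 3 * d) ^ 2 + (c * c + (4 * (c * c) + c * d + d * (c ∸ d)))
  -- Only `d + (c ∸ d)` is rewritten to `c`; the factor `c ∸ d` in the gap stays.
  eq = subst (λ x → let f = x + d + x ; g = f + (x + d) in
      (g * g + f * f) + (f * g + (x + d) * f)
        ≡ (4 * x + 3 * d) ^ 2 + (x * x + (4 * (x * x) + x * d + d * (c ∸ d))))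
    (m+[n∸m]≡n (F[n]≤F[1+n] p)) (difference (c ∸ d) d)

corollary2 : ∀ (k n : ℕ) → k ≥ 1 → n ≥ 1 →
    (F k ≡ L n ^ 2) ⇔ ((k , n) ≡ (1 , 1) ⊎ (k , n) ≡ (2 , 1))
corollary2 k n k≥1 n≥1 = mk⇔ (to k n k≥1 n≥1) from
  where
  to : ∀ k n → k ≥ 1 → n ≥ 1 → F k ≡ L n ^ 2 → (k , n) ≡ (1 , 1) ⊎ (k , n) ≡ (2 , 1)
  to 1 1 _ _ _ = inj₁ refl
  to 2 1 _ _ _ = inj₂ refl
  -- From index 3 on, Fibonacci numbers are at least `F 3 = 2`.
  to (suc (suc (suc k))) 1 _ _ Fk≡1 =
    contradiction (subst (2 ≤_) Fk≡1 (F-mono-≤ {3} {3 + k} (s≤s (s≤s (s≤s z≤n))))) λ { (s≤s ()) }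
  -- The general bounds fail here, since `L 2 ^ 2 = 9` exceeds `F 6 = 8`; it lies below `F 7 = 13`
  -- instead.
  to k 2 _ _ Fk≡9 = contradiction Fk≡9 (F-gap 6 (m≤m+n 9 0) (m≤m+n 10 3) k)
  to k (suc (suc (suc p))) _ _ Fk≡L² =
    contradiction Fk≡L² (F-gap (suc (3 + p + (3 + p))) (F<L² p) (L²<F p) k)

  from : (k , n) ≡ (1 , 1) ⊎ (k , n) ≡ (2 , 1) → F k ≡ L n ^ 2
  from (inj₁ refl) = refl
  from (inj₂ refl) = refl
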